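{- For every integer $t\ge 3$, there exists a pair of non $\epsilon$-cospectral $\epsilon$-equienergetic graphs on $12t$ vertices.
   Context: All graphs are finite, simple, undirected and connected. For a connected graph $G$ with distance function $d$, the eccentricity of a vertex $v$ is $e(v)=\max\{d(v,u):u\in V(G)\}$. The eccentricity matrix $\epsilon(G)$ is the symmetric matrix indexed by $V(G)$ with $(u,v)$ entry $d(u,v)$ if $d(u,v)=\min\{e(u),e(v)\}$, and $0$ otherwise. The $\epsilon$-spectrum of $G$ is the multiset of eigenvalues of $\epsilon(G)$, and the $\epsilon$-energy $E_\epsilon(G)$ is the sum of the absolute values of these eigenvalues (with multiplicity). Two non-isomorphic graphs of the same order are $\epsilon$-cospectral if they have the same $\epsilon$-spectrum, and non $\epsilon$-cospectral otherwise. Two graphs of the same order are $\epsilon$-equienergetic if they have the same $\epsilon$-energy. -}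

module Defs where

open import Level using (0ℓ)
open import Algebra.Bundles using (RawRing)
open import Data.Bool.Base using (Bool; true; false; if_then_else_)
import Data.Bool.Properties as Bool
open import Data.Fin.Base using (Fin; zero; suc; toℕ; punchIn)
import Data.Fin.Properties as Fin
open import Data.Fin.Permutation using (Permutation′; _⟨$⟩ʳ_)
open import Data.Integer.Base using (+_)
open import Data.Nat.Base as ℕ using (ℕ; zero; suc; z≤n; s≤s)
import Data.Nat.Properties as ℕ
open import Data.Product.Base using (Σ-syntax; ∃; ∃-syntax; _×_; _,_; proj₁; proj₂)
open import Data.Rational.Base as ℚ using (ℚ; 0ℚ; 1ℚ; ½)
import Data.Rational.Properties as ℚ
open import Data.Rational.Solver using (module +-*-Solver)
open import Data.Sum.Base using (inj₁; inj₂)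
open import Data.Vec.Functional using (Vector; foldr)
open import Relation.Binary.PropositionalEquality
  using (_≡_; refl; sym; trans; cong; subst)
open import Relation.Nullary using (¬_; Dec; yes; no; contradiction)
open import Relation.Nullary.Decidable using (⌊_⌋; map′; _×-dec_)
open import Relation.Unary using (Pred; Decidable)

------------------------------------------------------------------------
-- Real numbers, as Cauchy sequences of rationals with a modulus of
-- convergence, compared by the setoid equality _≃_

Cauchy : (ℕ → ℚ) → Set
Cauchy x = ∀ δ → 0ℚ ℚ.< δ →
  ∃[ N ] (∀ m n → N ℕ.≤ m → N ℕ.≤ n → ℚ.∣ x m ℚ.- x n ∣ ℚ.< δ)

record ℝ : Set where
  constructor mkℝ
  field
    seq    : ℕ → ℚ
    cauchy : Cauchy seq

open ℝ public

infix 4 _≃_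

_≃_ : ℝ → ℝ → Set
x ≃ y = ∀ δ → 0ℚ ℚ.< δ →
  ∃[ N ] (∀ n → N ℕ.≤ n → ℚ.∣ seq x n ℚ.- seq y n ∣ ℚ.< δ)

half-pos : ∀ {δ} → 0ℚ ℚ.< δ → 0ℚ ℚ.< ½ ℚ.* δ
half-pos {δ} 0<δ = subst (ℚ._< ½ ℚ.* δ) (ℚ.*-zeroʳ ½) (ℚ.*-monoʳ-<-pos ½ 0<δ)

halves : ∀ δ → ½ ℚ.* δ ℚ.+ ½ ℚ.* δ ≡ δ
halves δ = trans (sym (ℚ.*-distribʳ-+ δ ½ ½)) (ℚ.*-identityˡ δ)

abstract
  +-cauchy : ∀ {x y} → Cauchy x → Cauchy y → Cauchy (λ n → x n ℚ.+ y n)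
  +-cauchy {x} {y} cx cy δ 0<δ
    with cx (½ ℚ.* δ) (half-pos 0<δ) | cy (½ ℚ.* δ) (half-pos 0<δ)
  ... | M , x-close | N , y-close = M ℕ.⊔ N , λ m n M⊔N≤m M⊔N≤n → begin-strict
    ℚ.∣ (x m ℚ.+ y m) ℚ.- (x n ℚ.+ y n) ∣
      ≡⟨ cong ℚ.∣_∣ (rearrange (x m) (y m) (x n) (y n)) ⟩
    ℚ.∣ (x m ℚ.- x n) ℚ.+ (y m ℚ.- y n) ∣
      ≤⟨ ℚ.∣p+q∣≤∣p∣+∣q∣ (x m ℚ.- x n) (y m ℚ.- y n) ⟩
    ℚ.∣ x m ℚ.- x n ∣ ℚ.+ ℚ.∣ y m ℚ.- y n ∣
      <⟨ ℚ.+-mono-<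
           (x-close m n (ℕ.m⊔n≤o⇒m≤o M N M⊔N≤m) (ℕ.m⊔n≤o⇒m≤o M N M⊔N≤n))
           (y-close m n (ℕ.m⊔n≤o⇒n≤o M N M⊔N≤m) (ℕ.m⊔n≤o⇒n≤o M N M⊔N≤n)) ⟩
    ½ ℚ.* δ ℚ.+ ½ ℚ.* δ
      ≡⟨ halves δ ⟩
    δ ∎
    where
    open ℚ.≤-Reasoning
    rearrange : ∀ a b c d → (a ℚ.+ b) ℚ.- (c ℚ.+ d) ≡ (a ℚ.- c) ℚ.+ (b ℚ.- d)
    rearrange = solve 4 (λ a b c d → (a :+ b) :- (c :+ d) := (a :- c) :+ (b :- d)) refl
      where open +-*-Solver

abstract
  neg-cauchy : ∀ {x} → Cauchy x → Cauchy (λ n → ℚ.- x n)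
  neg-cauchy {x} cx δ 0<δ with cx δ 0<δ
  ... | N , x-close = N , λ m n N≤m N≤n →
    subst (ℚ._< δ)
      (trans (sym (ℚ.∣-p∣≡∣p∣ (x m ℚ.- x n))) (cong ℚ.∣_∣ (rearrange (x m) (x n))))
      (x-close m n N≤m N≤n)
    where
    rearrange : ∀ a b → ℚ.- (a ℚ.- b) ≡ (ℚ.- a) ℚ.- (ℚ.- b)
    rearrange = solve 2 (λ a b → :- (a :- b) := (:- a) :- (:- b)) refl
      where open +-*-Solver

∣p∣≤∣p-q∣+∣q∣ : ∀ p q → ℚ.∣ p ∣ ℚ.≤ ℚ.∣ p ℚ.- q ∣ ℚ.+ ℚ.∣ q ∣
∣p∣≤∣p-q∣+∣q∣ p q =
  subst (λ r → ℚ.∣ r ∣ ℚ.≤ ℚ.∣ p ℚ.- q ∣ ℚ.+ ℚ.∣ q ∣) (cancel p q)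
    (ℚ.∣p+q∣≤∣p∣+∣q∣ (p ℚ.- q) q)
  where
  cancel : ∀ p q → (p ℚ.- q) ℚ.+ q ≡ p
  cancel = solve 2 (λ p q → (p :- q) :+ q := p) refl
    where open +-*-Solver

eventually-bounded : ∀ {x} → Cauchy x →
  ∃[ B ] (0ℚ ℚ.< B × ∃[ N ] (∀ n → N ℕ.≤ n → ℚ.∣ x n ∣ ℚ.≤ B))
eventually-bounded {x} cx with cx 1ℚ (ℚ.positive⁻¹ 1ℚ)
... | N , close =
  1ℚ ℚ.+ ℚ.∣ x N ∣ ,
  ℚ.+-mono-<-≤ (ℚ.positive⁻¹ 1ℚ) (ℚ.0≤∣p∣ (x N)) ,
  N , λ n N≤n → ℚ.≤-trans (∣p∣≤∣p-q∣+∣q∣ (x n) (x N))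
    (ℚ.+-monoˡ-≤ ℚ.∣ x N ∣ (ℚ.<⇒≤ (close n N N≤n ℕ.≤-refl)))

divide : ∀ {δ B} → 0ℚ ℚ.< δ → 0ℚ ℚ.< B → ∃[ η ] (0ℚ ℚ.< η × B ℚ.* η ≡ δ)
divide {δ} {B} 0<δ 0<B = inv ℚ.* δ , pos , eq
  where
  instance
    B-pos : ℚ.Positive B
    B-pos = ℚ.positive 0<B
    B-nonZero : ℚ.NonZero B
    B-nonZero = ℚ.pos⇒nonZero B
  inv = ℚ.1/ B
  instance
    inv-pos : ℚ.Positive inv
    inv-pos = ℚ.1/pos⇒pos B
  pos : 0ℚ ℚ.< inv ℚ.* δ
  pos = subst (ℚ._< inv ℚ.* δ) (ℚ.*-zeroʳ inv) (ℚ.*-monoʳ-<-pos inv 0<δ)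
  eq : B ℚ.* (inv ℚ.* δ) ≡ δ
  eq = trans (sym (ℚ.*-assoc B inv δ))
         (trans (cong (ℚ._* δ) (ℚ.*-inverseʳ B)) (ℚ.*-identityˡ δ))

∣p*q∣<B*η : ∀ {p q B η} → 0ℚ ℚ.< B → ℚ.∣ p ∣ ℚ.≤ B → ℚ.∣ q ∣ ℚ.< η →
  ℚ.∣ p ℚ.* q ∣ ℚ.< B ℚ.* η
∣p*q∣<B*η {p} {q} {B} {η} 0<B p≤B q<η = begin-strict
  ℚ.∣ p ℚ.* q ∣        ≡⟨ ℚ.∣p*q∣≡∣p∣*∣q∣ p q ⟩
  ℚ.∣ p ∣ ℚ.* ℚ.∣ q ∣  ≤⟨ ℚ.*-monoʳ-≤-nonNeg ℚ.∣ q ∣ {{ℚ.∣-∣-nonNeg q}} p≤B ⟩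
  B ℚ.* ℚ.∣ q ∣        <⟨ ℚ.*-monoʳ-<-pos B {{ℚ.positive 0<B}} q<η ⟩
  B ℚ.* η              ∎
  where open ℚ.≤-Reasoning

*-close : ∀ a b c d {B C η} → 0ℚ ℚ.< B → 0ℚ ℚ.< C →
  ℚ.∣ a ∣ ℚ.≤ B → ℚ.∣ d ∣ ℚ.≤ C →
  ℚ.∣ a ℚ.- c ∣ ℚ.< η → ℚ.∣ b ℚ.- d ∣ ℚ.< η →
  ℚ.∣ a ℚ.* b ℚ.- c ℚ.* d ∣ ℚ.< (B ℚ.+ C) ℚ.* η
*-close a b c d {B} {C} {η} 0<B 0<C a≤B d≤C a-c<η b-d<η = begin-strict
  ℚ.∣ a ℚ.* b ℚ.- c ℚ.* d ∣
    ≡⟨ cong ℚ.∣_∣ (rearrange a b c d) ⟩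
  ℚ.∣ a ℚ.* (b ℚ.- d) ℚ.+ d ℚ.* (a ℚ.- c) ∣
    ≤⟨ ℚ.∣p+q∣≤∣p∣+∣q∣ (a ℚ.* (b ℚ.- d)) (d ℚ.* (a ℚ.- c)) ⟩
  ℚ.∣ a ℚ.* (b ℚ.- d) ∣ ℚ.+ ℚ.∣ d ℚ.* (a ℚ.- c) ∣
    <⟨ ℚ.+-mono-< (∣p*q∣<B*η {a} {b ℚ.- d} {B} {η} 0<B a≤B b-d<η)
                  (∣p*q∣<B*η {d} {a ℚ.- c} {C} {η} 0<C d≤C a-c<η) ⟩
  B ℚ.* η ℚ.+ C ℚ.* η
    ≡⟨ ℚ.*-distribʳ-+ η B C ⟨
  (B ℚ.+ C) ℚ.* η ∎
  where
  open ℚ.≤-Reasoning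
  rearrange : ∀ a b c d →
    a ℚ.* b ℚ.- c ℚ.* d ≡ a ℚ.* (b ℚ.- d) ℚ.+ d ℚ.* (a ℚ.- c)
  rearrange = solve 4 (λ a b c d →
    a :* b :- c :* d := a :* (b :- d) :+ d :* (a :- c)) refl
    where open +-*-Solver

abstract
  *-cauchy : ∀ {x y} → Cauchy x → Cauchy y → Cauchy (λ n → x n ℚ.* y n)
  *-cauchy {x} {y} cx cy δ 0<δ =
    let B , 0<B , K , x≤B = eventually-bounded {x} cx
        C , 0<C , L , y≤C = eventually-bounded {y} cy
        η , 0<η , [B+C]η≡δ =
          divide {δ} {B ℚ.+ C} 0<δ (ℚ.+-mono-< {0ℚ} {B} {0ℚ} {C} 0<B 0<C)
        M , x-close = cx η 0<η
        N , y-close = cy η 0<η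
    in (K ℕ.⊔ L) ℕ.⊔ (M ℕ.⊔ N) , λ m n max≤m max≤n →
      let KL≤m = ℕ.m⊔n≤o⇒m≤o (K ℕ.⊔ L) (M ℕ.⊔ N) max≤m
          KL≤n = ℕ.m⊔n≤o⇒m≤o (K ℕ.⊔ L) (M ℕ.⊔ N) max≤n
          MN≤m = ℕ.m⊔n≤o⇒n≤o (K ℕ.⊔ L) (M ℕ.⊔ N) max≤m
          MN≤n = ℕ.m⊔n≤o⇒n≤o (K ℕ.⊔ L) (M ℕ.⊔ N) max≤n
      in
      subst (ℚ.∣ x m ℚ.* y m ℚ.- x n ℚ.* y n ∣ ℚ.<_) [B+C]η≡δ
        (*-close (x m) (y m) (x n) (y n) {B} {C} {η} 0<B 0<C
          (x≤B m (ℕ.m⊔n≤o⇒m≤o K L KL≤m))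
          (y≤C n (ℕ.m⊔n≤o⇒n≤o K L KL≤n))
          (x-close m n (ℕ.m⊔n≤o⇒m≤o M N MN≤m) (ℕ.m⊔n≤o⇒m≤o M N MN≤n))
          (y-close m n (ℕ.m⊔n≤o⇒n≤o M N MN≤m) (ℕ.m⊔n≤o⇒n≤o M N MN≤n)))

∣p∣-∣q∣≤∣p-q∣ : ∀ p q → ℚ.∣ p ∣ ℚ.- ℚ.∣ q ∣ ℚ.≤ ℚ.∣ p ℚ.- q ∣
∣p∣-∣q∣≤∣p-q∣ p q = begin
  ℚ.∣ p ∣ ℚ.- ℚ.∣ q ∣
    ≤⟨ ℚ.+-monoˡ-≤ (ℚ.- ℚ.∣ q ∣) (∣p∣≤∣p-q∣+∣q∣ p q) ⟩
  (ℚ.∣ p ℚ.- q ∣ ℚ.+ ℚ.∣ q ∣) ℚ.- ℚ.∣ q ∣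
    ≡⟨ cancel ℚ.∣ p ℚ.- q ∣ ℚ.∣ q ∣ ⟩
  ℚ.∣ p ℚ.- q ∣ ∎
  where
  open ℚ.≤-Reasoning
  cancel : ∀ a b → (a ℚ.+ b) ℚ.- b ≡ a
  cancel = solve 2 (λ a b → (a :+ b) :- b := a) refl
    where open +-*-Solver

∣∣p∣-∣q∣∣≤∣p-q∣ : ∀ p q → ℚ.∣ ℚ.∣ p ∣ ℚ.- ℚ.∣ q ∣ ∣ ℚ.≤ ℚ.∣ p ℚ.- q ∣
∣∣p∣-∣q∣∣≤∣p-q∣ p q with ℚ.∣p∣≡p∨∣p∣≡-p (ℚ.∣ p ∣ ℚ.- ℚ.∣ q ∣)
... | inj₁ eq = subst (ℚ._≤ ℚ.∣ p ℚ.- q ∣) (sym eq) (∣p∣-∣q∣≤∣p-q∣ p q)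
... | inj₂ eq = begin
  ℚ.∣ ℚ.∣ p ∣ ℚ.- ℚ.∣ q ∣ ∣  ≡⟨ eq ⟩
  ℚ.- (ℚ.∣ p ∣ ℚ.- ℚ.∣ q ∣)  ≡⟨ swap ℚ.∣ p ∣ ℚ.∣ q ∣ ⟩
  ℚ.∣ q ∣ ℚ.- ℚ.∣ p ∣        ≤⟨ ∣p∣-∣q∣≤∣p-q∣ q p ⟩
  ℚ.∣ q ℚ.- p ∣              ≡⟨ cong ℚ.∣_∣ (swap p q) ⟨
  ℚ.∣ ℚ.- (p ℚ.- q) ∣        ≡⟨ ℚ.∣-p∣≡∣p∣ (p ℚ.- q) ⟩
  ℚ.∣ p ℚ.- q ∣              ∎
  where
  open ℚ.≤-Reasoning
  swap : ∀ a b → ℚ.- (a ℚ.- b) ≡ b ℚ.- a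
  swap = solve 2 (λ a b → :- (a :- b) := b :- a) refl
    where open +-*-Solver

abstract
  abs-cauchy : ∀ {x} → Cauchy x → Cauchy (λ n → ℚ.∣ x n ∣)
  abs-cauchy {x} cx δ 0<δ with cx δ 0<δ
  ... | N , x-close = N , λ m n N≤m N≤n →
    ℚ.≤-<-trans (∣∣p∣-∣q∣∣≤∣p-q∣ (x m) (x n)) (x-close m n N≤m N≤n)

abstract
  fromℚ-cauchy : ∀ q → Cauchy (λ _ → q)
  fromℚ-cauchy q δ 0<δ = 0 , λ _ _ _ _ →
    subst (ℚ._< δ) (sym (cong ℚ.∣_∣ (ℚ.+-inverseʳ q))) 0<δ

fromℚ : ℚ → ℝ
fromℚ q = mkℝ (λ _ → q) (fromℚ-cauchy q)

fromℕ : ℕ → ℝ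
fromℕ k = fromℚ (+ k ℚ./ 1)

infixl 6 _+_ _-_
infixl 7 _*_
infix  8 -_

_+_ : ℝ → ℝ → ℝ
x + y = mkℝ (λ n → seq x n ℚ.+ seq y n)
  (+-cauchy {seq x} {seq y} (cauchy x) (cauchy y))

_*_ : ℝ → ℝ → ℝ
x * y = mkℝ (λ n → seq x n ℚ.* seq y n)
  (*-cauchy {seq x} {seq y} (cauchy x) (cauchy y))

-_ : ℝ → ℝ
- x = mkℝ (λ n → ℚ.- seq x n) (neg-cauchy {seq x} (cauchy x))

_-_ : ℝ → ℝ → ℝ
x - y = x + (- y)

∣_∣ : ℝ → ℝ
∣ x ∣ = mkℝ (λ n → ℚ.∣ seq x n ∣) (abs-cauchy {seq x} (cauchy x))

0# 1# : ℝ
0# = fromℚ 0ℚ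
1# = fromℚ 1ℚ

ℝ-rawRing : RawRing 0ℓ 0ℓ
ℝ-rawRing = record
  { Carrier = ℝ
  ; _≈_     = _≃_
  ; _+_     = _+_
  ; _*_     = _*_
  ; -_      = -_
  ; 0#      = 0#
  ; 1#      = 1#
  }

open import Algebra.Definitions.RawSemiring (RawRing.rawSemiring ℝ-rawRing) public
  using (sum; product; _^_)

------------------------------------------------------------------------
-- Matrices and spectra

Matrix : ℕ → Set
Matrix n = Vector (Vector ℝ n) n

-- Laplace expansion along the first row.
det : ∀ {n} → Matrix n → ℝ
det {zero}  A = 1#
det {suc n} A = sum λ j →
  ((- 1#) ^ toℕ j) * (A zero j * det (λ i k → A (suc i) (punchIn j k)))

scalar : ∀ {n} → ℝ → Matrix n
scalar x i j = if ⌊ i Fin.≟ j ⌋ then x else 0#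

charPoly : ∀ {n} → Matrix n → ℝ → ℝ
charPoly A x = det (λ i j → scalar x i j - A i j)

-- λs lists the eigenvalues of A with (algebraic) multiplicity: the
-- characteristic polynomial of A is the product of the x - λs i. The order of
-- the list is immaterial.
IsSpectrum : ∀ {n} → Matrix n → Vector ℝ n → Set
IsSpectrum A λs = ∀ x → charPoly A x ≃ product (λ i → x - λs i)

------------------------------------------------------------------------
-- Graphs

record Graph (n : ℕ) : Set where
  field
    adj        : Fin n → Fin n → Bool
    adj-sym    : ∀ u v → adj u v ≡ adj v u
    adj-irrefl : ∀ v → adj v v ≡ false

  data Walk : ℕ → Fin n → Fin n → Set where
    []  : ∀ {v} → Walk 0 v v
    _∷_ : ∀ {k u w v} → adj u w ≡ true → Walk k w v → Walk (suc k) u v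

  walk? : ∀ k u v → Dec (Walk k u v)
  walk? zero    u v = map′ (λ { refl → [] }) (λ { [] → refl }) (u Fin.≟ v)
  walk? (suc k) u v = map′ (λ { (_ , e , p) → e ∷ p }) (λ { (e ∷ p) → _ , e , p })
    (Fin.any? λ w → (adj u w Bool.≟ true) ×-dec walk? k w v)

least : ∀ {P : Pred ℕ 0ℓ} → Decidable P → ∃ P →
  ∃[ k ] (P k × (∀ j → P j → k ℕ.≤ j))
least {P} P? (k , Pk) = search P P? k Pk
  where
  search : ∀ (P : Pred ℕ 0ℓ) → Decidable P → ∀ k → P k →
    ∃[ k ] (P k × (∀ j → P j → k ℕ.≤ j))
  search P P? zero    P0 = 0 , P0 , λ _ _ → z≤n
  search P P? (suc k) Pk with P? 0
  ... | yes P0 = 0 , P0 , λ _ _ → z≤n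
  ... | no ¬P0 with search (λ j → P (suc j)) (λ j → P? (suc j)) k Pk
  ...   | m , Pm , m-least = suc m , Pm , λ
    { zero    P0 → contradiction P0 ¬P0
    ; (suc j) Pj → s≤s (m-least j Pj)
    }

record ConnectedGraph (n : ℕ) : Set where
  field
    graph     : Graph n
    connected : ∀ u v → ∃[ k ] Graph.Walk graph k u v

  open Graph graph public

  distance : ∀ u v → ∃[ k ] (Walk k u v × (∀ j → Walk j u v → k ℕ.≤ j))
  distance u v = least (λ k → walk? k u v) (connected u v)

  d : Fin n → Fin n → ℕ
  d u v = proj₁ (distance u v)

  e : Fin n → ℕ
  e v = foldr ℕ._⊔_ 0 (d v)

  eccentricityMatrix : Matrix n
  eccentricityMatrix u v =
    if ⌊ d u v ℕ.≟ e u ℕ.⊓ e v ⌋ then fromℕ (d u v) else 0#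

open ConnectedGraph using (adj; eccentricityMatrix)

module _ {n : ℕ} where

  Isomorphic : ConnectedGraph n → ConnectedGraph n → Set
  Isomorphic G H = Σ[ π ∈ Permutation′ n ]
    (∀ u v → adj G u v ≡ adj H (π ⟨$⟩ʳ u) (π ⟨$⟩ʳ v))

  IsεSpectrum : ConnectedGraph n → Vector ℝ n → Set
  IsεSpectrum G = IsSpectrum (eccentricityMatrix G)

  SameεSpectrum : ConnectedGraph n → ConnectedGraph n → Set
  SameεSpectrum G H = ∃[ λs ] (IsεSpectrum G λs × IsεSpectrum H λs)

  -- Cospectrality is only considered for non-isomorphic graphs, so being
  -- non ε-cospectral is not the negation of being ε-cospectral: the graphs are
  -- non-isomorphic and their spectra differ.
  NonεCospectral : ConnectedGraph n → ConnectedGraph n → Set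
  NonεCospectral G H = ¬ Isomorphic G H × ¬ SameεSpectrum G H

  -- E is the ε-energy of G; the spectrum, and hence E, is determined by G.
  IsεEnergy : ConnectedGraph n → ℝ → Set
  IsεEnergy G E = ∃[ λs ] (IsεSpectrum G λs × E ≃ sum (λ i → ∣ λs i ∣))

  εEquienergetic : ConnectedGraph n → ConnectedGraph n → Set
  εEquienergetic G H = ∃[ E ] (IsεEnergy G E × IsεEnergy H E)

{-# OPTIONS --safe #-}
-- If every vertex of F has a neighbour and the complement G of F has diameter
-- two, then every eccentricity of G is 2 and ε(G) is twice the adjacency matrix
-- of F. We take for F the disjoint unions C₄ ⊎ kK₂ and 2K₂ ⊎ kK₂. Their
-- spectra differ, but C₄ (eigenvalues 2, -2, 0, 0) and 2K₂ (eigenvalues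
-- 1, -1, 1, -1) have the same energy. The complements are not isomorphic since
-- only in the first one some vertex has two non-neighbours.
module Submission where

open import Defs
open import Data.Nat.Base using (ℕ; _≤_) renaming (_*_ to _*ℕ_)
open import Data.Product.Base using (Σ-syntax; _×_)

open import Level using (0ℓ)
open import Algebra.Bundles using (CommutativeRing; RawRing)
open import Algebra.Morphism.Structures using (IsRingMonomorphism)
open import Data.Bool.Base using (Bool; true; false; not; _∨_; _xor_; if_then_else_)
open import Data.Bool.Properties using (xor-comm; xor-same; ∨-zeroʳ)
open import Data.Fin.Base using (Fin; zero; suc; toℕ; punchIn; _↑ʳ_)
open import Data.Fin.Permutation using (Permutation′; _⟨$⟩ʳ_; _⟨$⟩ˡ_; inverseˡ)
open import Data.Integer.Base using (+_)
open import Data.Nat.Base using (zero; suc; z≤n; s≤s; _⊔_; _⊓_)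
open import Data.Product.Base using (∃-syntax; _,_; proj₁; proj₂)
open import Data.Rational.Base using (ℚ; 0ℚ; 1ℚ; ½; Positive)
open import Data.Vec.Functional using (Vector; foldr; []; _∷_)
open import Relation.Binary.PropositionalEquality using (_≡_; _≢_; refl; sym; trans; cong; cong₂; subst; module ≡-Reasoning)
open import Relation.Nullary using (¬_; yes; no; contradiction)
open import Relation.Nullary.Decidable using (⌊_⌋; isYes≗does)
import Algebra.Construct.Pointwise as Pointwise
import Algebra.Morphism.RingMonomorphism as RingMonomorphism
import Algebra.Properties.Monoid.Sum as Sum
import Data.Fin.Properties as Fin
import Data.Nat.Base as ℕ
import Data.Nat.Properties as ℕ
import Data.Rational.Base as ℚ
import Data.Rational.Properties as ℚ
import Relation.Binary.Reasoning.Setoid as SetoidReasoning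
open import Data.Rational.Solver using (module +-*-Solver)
open import Data.Nat.Solver renaming (module +-*-Solver to ℕ-Solver)

-- The commutative ring of reals under termwise equality

infix 4 _≈_

-- Equality of the approximating sequences. It is finer than _≃_ and satisfies
-- the ring laws exactly, so no modulus of convergence is needed.
record _≈_ (x y : ℝ) : Set where
  constructor pointwise
  field
    at : ∀ m → seq x m ≡ seq y m

open _≈_

≈⇒≃ : ∀ {x y} → x ≈ y → x ≃ y
≈⇒≃ {x} {y} x≈y δ 0<δ = 0 , λ n _ → subst (ℚ._< δ) (sym (begin
  ℚ.∣ seq x n ℚ.- seq y n ∣  ≡⟨ cong (λ q → ℚ.∣ q ℚ.- seq y n ∣) (at x≈y n) ⟩
  ℚ.∣ seq y n ℚ.- seq y n ∣  ≡⟨ cong ℚ.∣_∣ (ℚ.+-inverseʳ (seq y n)) ⟩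
  0ℚ                         ∎)) 0<δ
  where
  open ≡-Reasoning

ℕ→ℚ : CommutativeRing 0ℓ 0ℓ
ℕ→ℚ = Pointwise.commutativeRing ℕ ℚ.+-*-commutativeRing

ℝ≈-rawRing : RawRing 0ℓ 0ℓ
ℝ≈-rawRing = record { RawRing ℝ-rawRing hiding (_≈_) ; _≈_ = _≈_ }

-- All operations act termwise, so each homomorphism law is `refl`, and the ring laws can be pulled
-- back from sequences of rationals.
seq-isRingMonomorphism : IsRingMonomorphism ℝ≈-rawRing (CommutativeRing.rawRing ℕ→ℚ) seq
seq-isRingMonomorphism = record
  { isRingHomomorphism = record
    { isSemiringHomomorphism = record
      { isNearSemiringHomomorphism = record
        { +-isMonoidHomomorphism = record
          { isMagmaHomomorphism = record
            { isRelHomomorphism = record { cong = at }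
            ; homo = λ _ _ _ → refl
            }
          ; ε-homo = λ _ → refl
          }
        ; *-homo = λ _ _ _ → refl
        }
      ; 1#-homo = λ _ → refl
      }
    ; -‿homo = λ _ _ → refl
    }
  ; injective = pointwise
  }

ℝ-commutativeRing : CommutativeRing 0ℓ 0ℓ
ℝ-commutativeRing = record
  { isCommutativeRing = RingMonomorphism.isCommutativeRing seq-isRingMonomorphism
      (CommutativeRing.isCommutativeRing ℕ→ℚ)
  }

module R = CommutativeRing ℝ-commutativeRing
module Sum-ℝ = Sum R.+-monoid

-- Determinants

≡⇒≈ : ∀ {x y} → x ≡ y → x ≈ y
≡⇒≈ refl = R.refl

sum-zero : ∀ {n} {f : Vector ℝ n} → (∀ i → f i ≈ 0#) → sum f ≈ 0#
sum-zero {n} f≈0 = R.trans (Sum-ℝ.sum-cong-≋ f≈0) (Sum-ℝ.sum-replicate-zero n)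

det-cong : ∀ {n} {A B : Matrix n} → (∀ i j → A i j ≈ B i j) → det A ≈ det B
det-cong {zero}  A≈B = R.refl
det-cong {suc n} A≈B = Sum-ℝ.sum-cong-≋ λ j →
  R.*-congˡ {(- 1#) ^ toℕ j} (R.*-cong (A≈B zero j) (det-cong λ i k → A≈B (suc i) (punchIn j k)))

term-zero : ∀ {a} s b → a ≈ 0# → s * (a * b) ≈ 0#
term-zero s b a≈0 = R.trans (R.*-congˡ (R.trans (R.*-congʳ a≈0) (R.zeroˡ b))) (R.zeroʳ s)

det-expand₁ : ∀ {n} (A : Matrix (suc n)) → (∀ j → A zero (suc j) ≈ 0#) →
  det A ≈ A zero zero * det (λ i k → A (suc i) (suc k))
det-expand₁ A A₀≈0 = R.trans
  (R.+-cong (R.*-identityˡ _) (sum-zero λ j → term-zero _ _ (A₀≈0 j)))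
  (R.+-identityʳ _)

det-expand₂ : ∀ {n} (A : Matrix (suc (suc n))) → (∀ j → A zero (suc (suc j)) ≈ 0#) →
  det A ≈ A zero zero * det (λ i k → A (suc i) (suc k))
        - A zero (suc zero) * det (λ i k → A (suc i) (punchIn (suc zero) k))
det-expand₂ A A₀≈0 = R.+-cong (R.*-identityˡ _) (R.trans
  (R.+-congˡ (sum-zero λ j → term-zero _ _ (A₀≈0 j)))
  -- The cofactor sign `(- 1#) ^ 1` unfolds to `(- 1#) * 1#`, and `con 0ℚ` is the vanished tail of
  -- the sum.
  (pointwise λ m → solve 2 (λ a b → (con (ℚ.- 1ℚ) :* con 1ℚ) :* (a :* b) :+ con 0ℚ := :- (a :* b)) refl
           (seq (A zero (suc zero)) m) (seq (det λ i k → A (suc i) (punchIn (suc zero) k)) m)))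
  where
  open +-*-Solver

-- Relations and their disjoint unions with complete graphs on two vertices

Relation : ℕ → Set
Relation n = Fin n → Fin n → Bool

infixr 5 K₂⊎_

K₂⊎_ : ∀ {n} → Relation n → Relation (suc (suc n))
(K₂⊎ F) zero          (suc zero)    = true
(K₂⊎ F) (suc zero)    zero          = true
(K₂⊎ F) (suc (suc u)) (suc (suc v)) = F u v
(K₂⊎ F) zero          zero          = false
(K₂⊎ F) zero          (suc (suc _)) = false
(K₂⊎ F) (suc zero)    (suc _)       = false
(K₂⊎ F) (suc (suc _)) zero          = false
(K₂⊎ F) (suc (suc _)) (suc zero)    = false

twice : ∀ {n} → Relation n → Matrix n
twice F u v = if F u v then fromℕ 2 else 0#

-- Stated with `_≈_`, so that ring congruences rewrite inside products; `isεSpectrum` passes to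
-- `_≃_`.
HasSpectrum : ∀ {n} → Relation n → Vector ℝ n → Set
HasSpectrum F λs = ∀ x → charPoly (twice F) x ≈ product (λ i → x - λs i)

±2∷_ : ∀ {n} → Vector ℝ n → Vector ℝ (suc (suc n))
±2∷ λs = fromℕ 2 ∷ - fromℕ 2 ∷ λs

-- The two comparisons are different decisions with the same `does`, so the proof goes from `⌊_⌋` to
-- `does` and back.
scalar-suc : ∀ {n} x (i j : Fin n) → scalar x (suc i) (suc j) ≡ scalar x i j
scalar-suc x i j = cong (λ b → if b then x else 0#)
  (trans (isYes≗does (suc i Fin.≟ suc j)) (sym (isYes≗does (i Fin.≟ j))))

-- The first two rows vanish outside the leading two-by-two block, whose determinant is x² - 4 = (x
-- - 2)(x + 2).
charPoly-K₂⊎ : ∀ {n} (F : Relation n) x →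
  charPoly (twice (K₂⊎ F)) x ≈ (x - fromℕ 2) * ((x - - fromℕ 2) * charPoly (twice F) x)
charPoly-K₂⊎ F x = begin
  det A
    ≈⟨ det-expand₂ A (λ _ → 0-0≈0) ⟩
  A zero zero * det (λ i k → A (suc i) (suc k))
    - A zero (suc zero) * det (λ i k → A (suc i) (punchIn (suc zero) k))
    ≈⟨ R.+-cong
         (R.*-congˡ {A zero zero} (det-expand₁ (λ i k → A (suc i) (suc k)) λ _ → 0-0≈0))
         (R.-‿cong (R.*-congˡ {A zero (suc zero)}
           (det-expand₁ (λ i k → A (suc i) (punchIn (suc zero) k)) λ _ → 0-0≈0))) ⟩
  A zero zero * (A (suc zero) (suc zero) * p) - A zero (suc zero) * (A (suc zero) zero * p)
    ≈⟨ pointwise (λ m → factor (seq x m) (seq p m)) ⟩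
  (x - fromℕ 2) * ((x - - fromℕ 2) * p)
    ≈⟨ R.*-congˡ {x - fromℕ 2} (R.*-congˡ {x - - fromℕ 2} (det-cong λ i j →
         R.+-congʳ { - twice F i j} (≡⇒≈
           (trans (scalar-suc x (suc i) (suc j)) (scalar-suc x i j))))) ⟩
  (x - fromℕ 2) * ((x - - fromℕ 2) * charPoly (twice F) x) ∎
  where
  A : Matrix _
  A i j = scalar x i j - twice (K₂⊎ F) i j
  p : ℝ
  p = det λ i k → A (suc (suc i)) (suc (suc k))
  0-0≈0 : 0# - 0# ≈ 0#
  0-0≈0 = pointwise λ _ → refl
  open +-*-Solver
  open SetoidReasoning R.setoid
  2ℚ : ℚ
  2ℚ = + 2 ℚ./ 1
  factor : ∀ x p →
    (x ℚ.- 0ℚ) ℚ.* ((x ℚ.- 0ℚ) ℚ.* p) ℚ.- (0ℚ ℚ.- 2ℚ) ℚ.* ((0ℚ ℚ.- 2ℚ) ℚ.* p)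
      ≡ (x ℚ.- 2ℚ) ℚ.* ((x ℚ.- (ℚ.- 2ℚ)) ℚ.* p)
  factor = solve 2 (λ x p →
    (x :- con 0ℚ) :* ((x :- con 0ℚ) :* p) :- (con 0ℚ :- con 2ℚ) :* ((con 0ℚ :- con 2ℚ) :* p)
      := (x :- con 2ℚ) :* ((x :- (:- con 2ℚ)) :* p)) refl

K₂⊎-spectrum : ∀ {n} (F : Relation n) λs → HasSpectrum F λs → HasSpectrum (K₂⊎ F) (±2∷ λs)
K₂⊎-spectrum F λs spec x = R.trans (charPoly-K₂⊎ F x)
  (R.*-congˡ {x - fromℕ 2} (R.*-congˡ {x - - fromℕ 2} (spec x)))

-- Spectra and energies of the two unions

side : Fin 4 → Bool
side zero          = false
side (suc zero)    = false
side (suc (suc _)) = true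

-- C₄ is the complete bipartite graph between {0, 1} and {2, 3}.
C₄ : Relation 4
C₄ u v = side u xor side v

-- The eigenvalues of `twice C₄`, hence twice those of the cycle.
C₄-eigenvalues : Vector ℝ 4
C₄-eigenvalues = fromℕ 4 ∷ - fromℕ 4 ∷ 0# ∷ 0# ∷ []

module _ where
  open +-*-Solver

  -- Its evaluation unfolds to det, which makes the solver applicable to determinants.
  det-poly : ∀ {m n} → (Fin n → Fin n → Polynomial m) → Polynomial m
  det-poly {n = zero}  A = con 1ℚ
  det-poly {n = suc n} A = foldr _:+_ (con 0ℚ) λ j →
    sign (toℕ j) :* (A zero j :* det-poly (λ i k → A (suc i) (punchIn j k)))
    where
    sign : ℕ → Polynomial _
    sign zero    = con 1ℚ
    sign (suc k) = con (ℚ.- 1ℚ) :* sign k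

  C₄-spectrum : HasSpectrum C₄ C₄-eigenvalues
  C₄-spectrum x = pointwise λ m → solve 1 (λ x →
    det-poly (λ i j → (if ⌊ i Fin.≟ j ⌋ then x else con 0ℚ) :- (if C₄ i j then con (+ 2 ℚ./ 1) else con 0ℚ))
      := (x :- con (+ 4 ℚ./ 1)) :* ((x :- (:- con (+ 4 ℚ./ 1))) :* ((x :- con 0ℚ) :* ((x :- con 0ℚ) :* con 1ℚ))))
    refl (seq x m)

K₂s : ∀ {n} k → Relation n → Relation (k ℕ.* 2 ℕ.+ n)
K₂s zero    F = F
K₂s (suc k) F = K₂⊎ K₂s k F

±2s : ∀ {n} k → Vector ℝ n → Vector ℝ (k ℕ.* 2 ℕ.+ n)
±2s zero    λs = λs
±2s (suc k) λs = ±2∷ ±2s k λs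

K₂s-spectrum : ∀ k {n} (F : Relation n) λs → HasSpectrum F λs → HasSpectrum (K₂s k F) (±2s k λs)
K₂s-spectrum zero    F λs spec = spec
K₂s-spectrum (suc k) F λs spec = K₂⊎-spectrum (K₂s k F) (±2s k λs) (K₂s-spectrum k F λs spec)

∅ : Relation 0
∅ ()

2K₂ : Relation 4
2K₂ = K₂⊎ K₂⊎ ∅

2K₂-eigenvalues : Vector ℝ 4
2K₂-eigenvalues = ±2∷ ±2∷ []

2K₂-spectrum : HasSpectrum 2K₂ 2K₂-eigenvalues
2K₂-spectrum = K₂⊎-spectrum (K₂⊎ ∅) (±2∷ []) (K₂⊎-spectrum ∅ [] λ _ → R.refl)

energy : ∀ {n} → Vector ℝ n → ℝ
energy λs = sum λ i → ∣ λs i ∣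

±2s-energy : ∀ k {n} {λs μs : Vector ℝ n} → energy λs ≈ energy μs → energy (±2s k λs) ≈ energy (±2s k μs)
±2s-energy zero    E≈ = E≈
±2s-energy (suc k) {λs = λs} {μs} E≈ =
  R.+-congˡ {∣ fromℕ 2 ∣} (R.+-congˡ {∣ - fromℕ 2 ∣} (±2s-energy k {λs = λs} {μs = μs} E≈))

charValue : ∀ {n} → Vector ℝ n → ℝ → ℝ
charValue λs x = product λ i → x - λs i

-- The point 4 separates the spectra: it is an eigenvalue of 2 A(C₄) but not of 2 A(K₂).
C₄-root : ∀ k → charValue (±2s k C₄-eigenvalues) (fromℕ 4) ≈ 0#
C₄-root zero    = pointwise λ _ → refl
C₄-root (suc k) = R.trans
  (R.*-congˡ {fromℕ 4 - fromℕ 2} (R.*-congˡ {fromℕ 4 - - fromℕ 2} (C₄-root k)))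
  (pointwise λ _ → refl)

-- Each K₂ contributes the factor (4 - 2)(4 + 2) = 12, and 144 = 12² comes from the base 2K₂. A
-- positive rational witness allows the value to be separated from `0#` under `_≃_`.
2K₂-nonroot : ∀ k → ∃[ q ] (Positive q × charValue (±2s k 2K₂-eigenvalues) (fromℕ 4) ≈ fromℚ q)
2K₂-nonroot zero    = + 144 ℚ./ 1 , _ , pointwise λ _ → refl
2K₂-nonroot (suc k) with 2K₂-nonroot k
... | q , q>0 , value≈q = 2ℚ ℚ.* (6ℚ ℚ.* q) ,
  ℚ.pos*pos⇒pos 2ℚ (6ℚ ℚ.* q) {{ℚ.pos*pos⇒pos 6ℚ q {{q>0}}}} ,
  R.trans (R.*-congˡ {fromℕ 4 - fromℕ 2} (R.*-congˡ {fromℕ 4 - - fromℕ 2} value≈q))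
    (pointwise λ _ → refl)
  where
  2ℚ 6ℚ : ℚ
  2ℚ = + 2 ℚ./ 1
  6ℚ = + 6 ℚ./ 1

-- Graphs with a given non-adjacency relation

-- A simple graph without isolated vertices: its edges cover the vertex set. A `partner` is at
-- distance 2 in the complement.
record IsCovering {n} (F : Relation n) : Set where
  field
    symmetric   : ∀ u v → F u v ≡ F v u
    irreflexive : ∀ v → F v v ≡ false
    partner     : ∀ u → ∃[ v ] F u v ≡ true

C₄-isCovering : IsCovering C₄
C₄-isCovering = record
  { symmetric   = λ u v → xor-comm (side u) (side v)
  ; irreflexive = λ v → xor-same (side v)
  ; partner     = λ
    { zero          → suc (suc zero) , refl
    ; (suc zero)    → suc (suc zero) , refl
    ; (suc (suc _)) → zero , refl
    }
  }

∅-isCovering : IsCovering ∅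
∅-isCovering = record { symmetric = λ () ; irreflexive = λ () ; partner = λ () }

K₂⊎-isCovering : ∀ {n} {F : Relation n} → IsCovering F → IsCovering (K₂⊎ F)
K₂⊎-isCovering {F = F} covering = record
  { symmetric = λ
    { zero          zero          → refl
    ; zero          (suc zero)    → refl
    ; zero          (suc (suc _)) → refl
    ; (suc zero)    zero          → refl
    ; (suc zero)    (suc zero)    → refl
    ; (suc zero)    (suc (suc _)) → refl
    ; (suc (suc _)) zero          → refl
    ; (suc (suc _)) (suc zero)    → refl
    ; (suc (suc u)) (suc (suc v)) → symmetric u v
    }
  ; irreflexive = λ
    { zero          → refl
    ; (suc zero)    → refl
    ; (suc (suc v)) → irreflexive v
    }
  ; partner = λ
    { zero          → suc zero , refl
    ; (suc zero)    → zero , refl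
    ; (suc (suc u)) → let v , Fuv = partner u in suc (suc v) , Fuv
    }
  }
  where
  open IsCovering covering

K₂s-isCovering : ∀ k {n} {F : Relation n} → IsCovering F → IsCovering (K₂s k F)
K₂s-isCovering zero    covering = covering
K₂s-isCovering (suc k) covering = K₂⊎-isCovering (K₂s-isCovering k covering)

co : ∀ {n} → Relation n → Relation n
co F u v = not (F u v ∨ ⌊ u Fin.≟ v ⌋)

module _ {n : ℕ} {F : Relation n} where

  F⇒¬co : ∀ {u v} → F u v ≡ true → co F u v ≡ false
  F⇒¬co Fuv rewrite Fuv = refl

  co-irrefl : ∀ v → co F v v ≡ false
  co-irrefl v with v Fin.≟ v
  ... | yes _   = cong not (∨-zeroʳ (F v v))
  ... | no  v≢v = contradiction refl v≢v

  ¬F⇒co : ∀ {u v} → F u v ≡ false → u ≢ v → co F u v ≡ true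
  ¬F⇒co {u} {v} Fuv u≢v rewrite Fuv with u Fin.≟ v
  ... | yes u≡v = contradiction u≡v u≢v
  ... | no  _   = refl

  ¬co⇒F : ∀ {u v} → co F u v ≡ false → u ≢ v → F u v ≡ true
  ¬co⇒F {u} {v} ¬co u≢v with F u v in eq
  ... | true  = refl
  ... | false with u Fin.≟ v
  ...   | yes u≡v = contradiction u≡v u≢v
  ...   | no  _   = contradiction ¬co λ ()

  co-sym : IsCovering F → ∀ u v → co F u v ≡ co F v u
  co-sym covering u v with u Fin.≟ v | v Fin.≟ u
  ... | yes _   | yes _   = cong (λ b → not (b ∨ true)) (IsCovering.symmetric covering u v)
  ... | no  _   | no  _   = cong (λ b → not (b ∨ false)) (IsCovering.symmetric covering u v)
  ... | yes u≡v | no  v≢u = contradiction (sym u≡v) v≢u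
  ... | no  u≢v | yes v≡u = contradiction (sym v≡u) u≢v

-- Eccentricities in complements of diameter two

≤-max : ∀ {n} (f : Vector ℕ n) i → f i ≤ foldr _⊔_ 0 f
≤-max f zero    = ℕ.m≤m⊔n _ _
≤-max f (suc i) = ℕ.≤-trans (≤-max (λ j → f (suc j)) i) (ℕ.m≤n⊔m (f zero) _)

max-≤ : ∀ {n b} (f : Vector ℕ n) → (∀ i → f i ≤ b) → foldr _⊔_ 0 f ≤ b
max-≤ {zero}  f f≤b = z≤n
max-≤ {suc n} f f≤b = ℕ.⊔-lub (f≤b zero) (max-≤ (λ j → f (suc j)) λ i → f≤b (suc i))

module DiameterTwo {n : ℕ} (F : Relation n) (covering : IsCovering F)
  (detour : ∀ u v → F u v ≡ true → ∃[ w ] (co F u w ≡ true × co F w v ≡ true)) where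

  open IsCovering covering

  complement : Graph n
  complement = record
    { adj        = co F
    ; adj-sym    = co-sym covering
    ; adj-irrefl = co-irrefl {F = F}
    }

  open Graph complement using (Walk) renaming ([] to nil; _∷_ to _▸_)

  -- Distinct vertices unrelated by `F` are adjacent in the complement; related ones have a common
  -- neighbour there by `detour`.
  short-walk : ∀ u v → ∃[ k ] (Walk k u v × k ≤ 2)
  short-walk u v with u Fin.≟ v
  ... | yes refl = 0 , nil , z≤n
  ... | no  u≢v with F u v in eq
  ...   | true  = let w , uw , wv = detour u v eq in 2 , uw ▸ (wv ▸ nil) , s≤s (s≤s z≤n)
  ...   | false = 1 , ¬F⇒co {F = F} eq u≢v ▸ nil , s≤s z≤n

  -- Vertices related by `F` are neither equal nor adjacent in the complement, which rules out
  -- lengths 0 and 1.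
  F⇒long-walk : ∀ {k u v} → F u v ≡ true → Walk k u v → 2 ≤ k
  F⇒long-walk {v = v} Fuv nil = contradiction (trans (sym Fuv) (irreflexive v)) λ ()
  F⇒long-walk Fuv (uv ▸ nil)      = contradiction (trans (sym uv) (F⇒¬co {F = F} Fuv)) λ ()
  F⇒long-walk Fuv (_ ▸ (_ ▸ _))   = s≤s (s≤s z≤n)

  ¬F⇒short-walk : ∀ {u v} → F u v ≡ false → ∃[ k ] (Walk k u v × k ≤ 1)
  ¬F⇒short-walk {u} {v} ¬Fuv with u Fin.≟ v
  ... | yes refl = 0 , nil , z≤n
  ... | no  u≢v  = 1 , ¬F⇒co {F = F} ¬Fuv u≢v ▸ nil , s≤s z≤n

  G : ConnectedGraph n
  G = record
    { graph     = complement
    ; connected = λ u v → let k , walk , _ = short-walk u v in k , walk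
    }

  open ConnectedGraph G using (distance; d; e; eccentricityMatrix)

  d≤length : ∀ {k u v} → Walk k u v → d u v ≤ k
  d≤length {k} {u} {v} walk = proj₂ (proj₂ (distance u v)) k walk

  d≤2 : ∀ u v → d u v ≤ 2
  d≤2 u v = let _ , walk , k≤2 = short-walk u v in ℕ.≤-trans (d≤length walk) k≤2

  F⇒d≡2 : ∀ {u v} → F u v ≡ true → d u v ≡ 2
  F⇒d≡2 {u} {v} Fuv = ℕ.≤-antisym (d≤2 u v) (F⇒long-walk Fuv (proj₁ (proj₂ (distance u v))))

  ¬F⇒d≢2 : ∀ {u v} → F u v ≡ false → d u v ≢ 2
  ¬F⇒d≢2 ¬Fuv d≡2 = let _ , walk , k≤1 = ¬F⇒short-walk ¬Fuv in
    ℕ.<⇒≢ (s≤s (ℕ.≤-trans (d≤length walk) k≤1)) d≡2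

  e≡2 : ∀ v → e v ≡ 2
  e≡2 v = let w , Fvw = partner v in ℕ.≤-antisym (max-≤ (d v) (d≤2 v))
    (subst (_≤ e v) (F⇒d≡2 Fvw) (≤-max (d v) w))

  -- As every eccentricity is 2, an entry survives exactly at distance 2, that is, on the pairs
  -- related by `F`.
  eccentricityMatrix≡twice : ∀ u v → eccentricityMatrix u v ≡ twice F u v
  eccentricityMatrix≡twice u v with d u v ℕ.≟ e u ⊓ e v | F u v in eq
  ... | yes _   | true  = cong fromℕ (F⇒d≡2 eq)
  ... | no  _   | false = refl
  ... | yes d≡e | false = contradiction (trans d≡e (cong₂ _⊓_ (e≡2 u) (e≡2 v))) (¬F⇒d≢2 eq)
  ... | no  d≢e | true  =
    contradiction (trans (F⇒d≡2 eq) (sym (cong₂ _⊓_ (e≡2 u) (e≡2 v)))) d≢e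

  charPoly-G : ∀ x → charPoly eccentricityMatrix x ≈ charPoly (twice F) x
  charPoly-G x = det-cong λ u v →
    ≡⇒≈ (cong (λ a → scalar x u v - a) (eccentricityMatrix≡twice u v))

  isεSpectrum : ∀ λs → HasSpectrum F λs → IsεSpectrum G λs
  isεSpectrum λs spec x = ≈⇒≃ (R.trans (charPoly-G x) (spec x))

-- In the complement, each new vertex is adjacent to each old one. The ends of the new edge
-- therefore meet at an old vertex, which has to exist, and two old vertices meet at `zero`.
K₂⊎-detour : ∀ {n} (F : Relation n) → Fin n → ∀ u v → (K₂⊎ F) u v ≡ true →
  ∃[ w ] (co (K₂⊎ F) u w ≡ true × co (K₂⊎ F) w v ≡ true)
K₂⊎-detour F w zero          (suc zero)    _ = suc (suc w) , refl , refl
K₂⊎-detour F w (suc zero)    zero          _ = suc (suc w) , refl , refl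
K₂⊎-detour F _ (suc (suc _)) (suc (suc _)) _ = zero , refl , refl

-- Degrees in the non-adjacency relation as an isomorphism invariant

Branching : ∀ {n} → Relation n → Set
Branching F = ∃[ v ] ∃[ p ] ∃[ q ] (F v p ≡ true × F v q ≡ true × p ≢ q)

C₄-branching : ∀ k → Branching (K₂s k C₄)
C₄-branching zero    = zero , suc (suc zero) , suc (suc (suc zero)) , refl , refl , λ ()
C₄-branching (suc k) =
  let v , p , q , Fvp , Fvq , p≢q = C₄-branching k
  in suc (suc v) , suc (suc p) , suc (suc q) , Fvp , Fvq ,
     λ p≡q → p≢q (Fin.suc-injective (Fin.suc-injective p≡q))

Matching : ∀ {n} → Relation n → Set
Matching F = ∀ v p q → F v p ≡ true → F v q ≡ true → p ≡ q

K₂⊎-matching : ∀ {n} {F : Relation n} → Matching F → Matching (K₂⊎ F)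
K₂⊎-matching matching zero          (suc zero)    (suc zero)    _   _   = refl
K₂⊎-matching matching (suc zero)    zero          zero          _   _   = refl
K₂⊎-matching matching (suc (suc v)) (suc (suc p)) (suc (suc q)) Fvp Fvq =
  cong (λ i → suc (suc i)) (matching v p q Fvp Fvq)

K₂s-matching : ∀ k {n} {F : Relation n} → Matching F → Matching (K₂s k F)
K₂s-matching zero    matching = matching
K₂s-matching (suc k) matching = K₂⊎-matching (K₂s-matching k matching)

-- An isomorphism of complements also preserves non-adjacency of distinct vertices, so it would send
-- two `F`-neighbours of `v` to two distinct `F′`-neighbours of its image.
co-iso⇒¬branching : ∀ {n} {F F′ : Relation n} → IsCovering F → Branching F → Matching F′ →
  (π : Permutation′ n) → ¬ (∀ u v → co F u v ≡ co F′ (π ⟨$⟩ʳ u) (π ⟨$⟩ʳ v))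
co-iso⇒¬branching {F = F} {F′} covering (v , p , q , Fvp , Fvq , p≢q) matching π iso =
  p≢q (π-injective (matching _ _ _ (preserves Fvp) (preserves Fvq)))
  where
  open IsCovering covering
  π-injective : ∀ {i j} → π ⟨$⟩ʳ i ≡ π ⟨$⟩ʳ j → i ≡ j
  π-injective πi≡πj = trans (sym (inverseˡ π)) (trans (cong (π ⟨$⟩ˡ_) πi≡πj) (inverseˡ π))
  preserves : ∀ {u w} → F u w ≡ true → F′ (π ⟨$⟩ʳ u) (π ⟨$⟩ʳ w) ≡ true
  preserves {u} {w} Fuw = ¬co⇒F {F = F′} (trans (sym (iso u w)) (F⇒¬co {F = F} Fuw))
    -- Non-adjacency in the complement also covers equal vertices; irreflexivity of `F` excludes
    -- that case.
    λ πu≡πw → contradiction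
      (trans (sym Fuw) (trans (cong (F u) (sym (π-injective πu≡πw))) (irreflexive u))) λ ()

-- Comparing reals under the Cauchy equality

≃-respˡ-≈ : ∀ {x y} z → x ≈ y → x ≃ z → y ≃ z
≃-respˡ-≈ z x≈y x≃z δ 0<δ = let N , close = x≃z δ 0<δ in
  N , λ n N≤n → subst (λ q → ℚ.∣ q ℚ.- seq z n ∣ ℚ.< δ) (at x≈y n) (close n N≤n)

≃-leftEuclidean : ∀ x y z → x ≃ z → y ≃ z → x ≃ y
≃-leftEuclidean x y z x≃z y≃z δ 0<δ =
  let M , x-close = x≃z (½ ℚ.* δ) (half-pos 0<δ)
      N , y-close = y≃z (½ ℚ.* δ) (half-pos 0<δ)
  in M ⊔ N , λ n M⊔N≤n → begin-strict
    ℚ.∣ seq x n ℚ.- seq y n ∣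
      ≡⟨ cong ℚ.∣_∣ (rearrange (seq x n) (seq y n) (seq z n)) ⟩
    ℚ.∣ (seq x n ℚ.- seq z n) ℚ.- (seq y n ℚ.- seq z n) ∣
      ≤⟨ ℚ.∣p-q∣≤∣p∣+∣q∣ (seq x n ℚ.- seq z n) (seq y n ℚ.- seq z n) ⟩
    ℚ.∣ seq x n ℚ.- seq z n ∣ ℚ.+ ℚ.∣ seq y n ℚ.- seq z n ∣
      <⟨ ℚ.+-mono-< (x-close n (ℕ.m⊔n≤o⇒m≤o M N M⊔N≤n)) (y-close n (ℕ.m⊔n≤o⇒n≤o M N M⊔N≤n)) ⟩
    ½ ℚ.* δ ℚ.+ ½ ℚ.* δ
      ≡⟨ halves δ ⟩
    δ ∎
  where
  open ℚ.≤-Reasoning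
  open +-*-Solver
  rearrange : ∀ a b c → a ℚ.- b ≡ (a ℚ.- c) ℚ.- (b ℚ.- c)
  rearrange = solve 3 (λ a b c → a :- b := (a :- c) :- (b :- c)) refl

-- With q itself as tolerance, closeness to zero would give q < q.
positive⇒≄0 : ∀ q → Positive q → ¬ (fromℚ q ≃ 0#)
positive⇒≄0 q q>0 q≃0 = let N , close = q≃0 q 0<q in
  ℚ.<-irrefl ∣q-0∣≡q (close N ℕ.≤-refl)
  where
  0<q : 0ℚ ℚ.< q
  0<q = ℚ.positive⁻¹ q {{q>0}}
  ∣q-0∣≡q : ℚ.∣ q ℚ.- 0ℚ ∣ ≡ q
  ∣q-0∣≡q = trans (cong ℚ.∣_∣ (ℚ.+-identityʳ q)) (ℚ.0≤p⇒∣p∣≡p (ℚ.<⇒≤ 0<q))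

-- The pair of graphs

EquienergeticPair : ℕ → Set
EquienergeticPair n =
  Σ[ G ∈ ConnectedGraph n ] Σ[ H ∈ ConnectedGraph n ] (NonεCospectral G H × εEquienergetic G H)

-- The index `suc k` provides at least one extra K₂, as `K₂⊎-detour` requires; the complement of C₄
-- alone is disconnected.
equienergeticPair : ∀ k → EquienergeticPair (suc k ℕ.* 2 ℕ.+ 4)
equienergeticPair k = C.G , M.G , (non-isomorphic , non-cospectral) , equienergetic
  where
  -- A vertex of the four-vertex base, through which the ends of the outermost K₂ are joined.
  old : Fin (k ℕ.* 2 ℕ.+ 4)
  old = k ℕ.* 2 ↑ʳ zero
  C-covering : IsCovering (K₂s (suc k) C₄)
  C-covering = K₂s-isCovering (suc k) C₄-isCovering
  M-covering : IsCovering (K₂s (suc k) 2K₂)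
  M-covering = K₂s-isCovering (suc k) (K₂⊎-isCovering (K₂⊎-isCovering ∅-isCovering))
  module C = DiameterTwo (K₂s (suc k) C₄) C-covering (K₂⊎-detour _ old)
  module M = DiameterTwo (K₂s (suc k) 2K₂) M-covering (K₂⊎-detour _ old)
  C-eigenvalues M-eigenvalues : Vector ℝ (suc k ℕ.* 2 ℕ.+ 4)
  C-eigenvalues = ±2s (suc k) C₄-eigenvalues
  M-eigenvalues = ±2s (suc k) 2K₂-eigenvalues
  C-spectrum : HasSpectrum (K₂s (suc k) C₄) C-eigenvalues
  C-spectrum = K₂s-spectrum (suc k) C₄ C₄-eigenvalues C₄-spectrum
  M-spectrum : HasSpectrum (K₂s (suc k) 2K₂) M-eigenvalues
  M-spectrum = K₂s-spectrum (suc k) 2K₂ 2K₂-eigenvalues 2K₂-spectrum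

  non-isomorphic : ¬ Isomorphic C.G M.G
  non-isomorphic (π , iso) =
    co-iso⇒¬branching C-covering (C₄-branching (suc k))
      (K₂s-matching (suc k) (K₂⊎-matching (K₂⊎-matching {F = ∅} λ ()))) π iso

  non-cospectral : ¬ SameεSpectrum C.G M.G
  non-cospectral (λs , C-λs , M-λs) =
    -- A common spectrum `λs` would make both characteristic polynomials equal `z` at 4, but one is
    -- `q` > 0 there and the other is 0.
    let q , q>0 , value≈q = 2K₂-nonroot (suc k)
        4ℝ = fromℕ 4
        z = charValue λs 4ℝ
    in positive⇒≄0 q q>0 (≃-leftEuclidean (fromℚ q) 0# z
      (≃-respˡ-≈ z (R.trans (M.charPoly-G 4ℝ) (R.trans (M-spectrum 4ℝ) value≈q)) (M-λs 4ℝ))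
      (≃-respˡ-≈ z (R.trans (C.charPoly-G 4ℝ) (R.trans (C-spectrum 4ℝ) (C₄-root (suc k)))) (C-λs 4ℝ)))

  equienergetic : εEquienergetic C.G M.G
  equienergetic = energy C-eigenvalues ,
    (C-eigenvalues , C.isεSpectrum C-eigenvalues C-spectrum , ≈⇒≃ (R.refl {energy C-eigenvalues})) ,
    (M-eigenvalues , M.isεSpectrum M-eigenvalues M-spectrum ,
      -- The bases have equal energy: 4 + 4 + 0 + 0 = 2 + 2 + 2 + 2. These are constant sequences,
      -- so this holds by computation.
      ≈⇒≃ (±2s-energy (suc k) {λs = C₄-eigenvalues} {μs = 2K₂-eigenvalues} (pointwise λ _ → refl)))

theorem5p1 : (t : ℕ) → 3 ≤ t →
    Σ[ G ∈ ConnectedGraph (12 *ℕ t) ] Σ[ H ∈ ConnectedGraph (12 *ℕ t) ]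
    (NonεCospectral G H × εEquienergetic G H)
theorem5p1 zero    ()
-- Here 6t + 4 copies of K₂ are added to the four base vertices, giving 2(6t + 4) + 4 = 12(t + 1)
-- vertices.
theorem5p1 (suc t) _ = subst EquienergeticPair (order t) (equienergeticPair (6 *ℕ t ℕ.+ 3))
  where
  open ℕ-Solver
  order : ∀ t → suc (6 *ℕ t ℕ.+ 3) ℕ.* 2 ℕ.+ 4 ≡ 12 *ℕ suc t
  order = solve 1 (λ t → (con 1 :+ (con 6 :* t :+ con 3)) :* con 2 :+ con 4
                           := con 12 :* (con 1 :+ t)) refl
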